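{- If $\psi$ is an $L$-formula with $n$ free variables, $M\in\mathrm{pSh}(\Omega,L)$ and $\bar a\in{}^n|M|$, then $[\psi(\bar a)]_M=[\psi^\exists(\bar a)]_M$.
   Context: **Presheaves.** Fix a complete Heyting algebra $\Omega$ (bottom $\bot$, top $\top$). A presheaf $M$ over $\Omega$ is a set $|M|$ of sections with maps $E:|M|\to\Omega$ (extent) and $\upharpoonright:|M|\times\Omega\to|M|$ (restriction) such that $a\upharpoonright Ea=a$, $E(a\upharpoonright p)=Ea\wedge p$, $(a\upharpoonright p)\upharpoonright q=a\upharpoonright(p\wedge q)$. Put $[a=b]_M=\bigvee\{p\le Ea\wedge Eb: a\upharpoonright p=b\upharpoonright p\}$; presheaves are extensional: $Ea=Eb=[a=b]_M$ implies $a=b$. For a tuple $\bar a$ of sections, $E\bar a=\bigwedge_iEa_i$ ($E\emptyset=\top$), $\bar a\upharpoonright p=\langle a_i\upharpoonright p\rangle_i$, $[\bar a=\bar b]_M=\bigwedge_i[a_i=b_i]_M$. **Structures.** A signature has finitary relation symbols, finitary function symbols and a presheaf over $\Omega$ of constant symbols (so each constant $c$ has an extent $Ec$). An element $M$ of $\mathrm{pSh}(\Omega,L)$ is a presheaf with: for each $n$-ary $R$ a map $R^M:|M|^n\to\Omega$ with $R^M(\bar a)\le E\bar a$ and $[\bar a=\bar b]_M\wedge R^M(\bar a)\le R^M(\bar b)$; for each $n$-ary $f$ a map $f^M:|M|^n\to|M|$ with $Ef^M(\bar a)=E\bar a$ and $[\bar a=\bar b]_M\le[f^M(\bar a)=f^M(\bar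 b)]_M$; for each constant $c$ a section $\mathfrak c^M$ with $E\mathfrak c^M=Ec$, compatibly with restriction. **Languages.** $L$ is one of $\bar L_{\omega\omega}$ (first order logic), $\bar L_{\infty\omega}$, $L_{\infty\lambda}$ ($\lambda$ an infinite cardinal). Terms are built from variables, constants and function symbols; atomic formulae are $t_0=t_1$ and $R(t_0,\dots,t_{m-1})$; formulae are closed under $\neg$, $\to$, conjunctions $\bigwedge\Phi$ and disjunctions $\bigvee\Phi$ (finite for $\bar L_{\omega\omega}$, over arbitrary sets otherwise) of sets of formulae with a common set of fewer than $\lambda$ free variables ($\lambda=\omega$ for the barred languages), and quantifiers $\forall V,\exists V$ over a single variable (barred languages) or over sets $V$ of fewer than $\lambda$ variables ($L_{\infty\lambda}$). **Interpretation.** For a term or formula $\chi$, $E\chi=\bigwedge\{Ec:c\text{ occurs in }\chi\}$. For $E\bar a\le Et$: $v_i^M(\bar a)=a_i$, $c^M(\bar a)=\mathfrak c^M\upharpoonright E\bar a$, $f(t_0,\dots)^M(\bar a)=f^M(t_0^M(\bar a),\dots)$. For a formula $\phi$ put $e=E\bar a\wedge E\phi$. For atomic $\phi$: $[(t=s)(\bar a)]_M=e\wedge[t^M(\bar a\upharpoonright E\phi)=s^M(\bar a\upharpoonright E\phi)]_M$, $[R(t_0,\dots)(\bar a)]_M=e\wedge R^M(t_0^M(\bar a\upharpoonright E\phi),\dots)$. The connectives $\bigwedge,\bigvee,\to,\neg$ are interpreted by the corresponding operations of $\Omega$, met with $e$; $[\exists V\psi(\bar a)]_M=e\wedge\bigvee_{\bar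 t\in{}^V|M|}[\psi(\bar t,\bar a)]_M$, $[\forall V\psi(\bar a)]_M=e\wedge\bigwedge_{\bar t\in{}^V|M|}(E\bar t\to[\psi(\bar t,\bar a)]_M)$. **Unnesting.** An atomic formula is unnested if it is of the form $v_i=v_j$, $v_i=c$, $R(v_{i_0},\dots,v_{i_{n-1}})$ or $v_{i_n}=f(v_{i_0},\dots,v_{i_{n-1}})$ (equations between a variable and a constant, or between a variable and $f$ applied to variables, count as unnested in either order). For atomic $\phi$ define $\phi^\exists$ recursively: $\phi^\exists=\phi$ for $\phi$ unnested. If $\phi$ is $c=d$ with $c,d$ constants, $\phi^\exists$ is $\exists v_0\,(v_0=c\wedge v_0=d)$. If $\phi$ is $f(t_0,\dots,t_{m-1})=t_m$ with not all $t_i$ variables, let $S$ be the set of $i\le m$ with $t_i$ not a variable; choose distinct new variables $x_i$ ($i\in S$) not occurring in any $t_k$, and put $x_i=t_i$ for $i\notin S$; $\phi^\exists$ is obtained by prefixing $\exists x_i$, one for each $i\in S$, to the conjunction of the formulae $(x_i=t_i)^\exists$ ($i\in S$) and $f(x_0,\dots,x_{m-1})=x_m$. If $\phi$ is $t_m=f(t_0,\dots,t_{m-1})$ do the same with last conjunct $x_m=f(x_0,\dots,x_{m-1})$. If $\phi$ is $R(t_0,\dots,t_{m-1})$ with not all $t_i$ variables, do the same with $S\subseteq\{0,\dots,m-1\}$ and last conjunct $R(x_0,\dots,x_{m-1})$. For an arbitrary formula $\psi$, $\psi^\exists$ is obtained by replacing each atomic subformula $\phi$ of $\psi$ by $\phi^\exists$.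 -}

module Defs where

open import Data.Empty.Polymorphic using (⊥)
open import Data.Fin.Base using (Fin; zero; suc; toℕ)
import Data.Fin.Properties as Fin
open import Data.List.Base as List using (List; []; _∷_; length; lookup; filter; allFin)
open import Data.List.Membership.Propositional using (_∈_)
open import Data.List.Membership.Propositional.Properties using (∈-allFin; ∈-map⁺; ∈-filter⁺)
open import Data.List.Relation.Unary.Any using (index)
open import Data.Nat.Base using (ℕ; zero; suc)
import Data.Nat.Properties as ℕ
open import Data.Product.Base using (Σ; ∃; _×_; _,_; proj₁)
open import Data.Sum.Base using (_⊎_; inj₁; inj₂; [_,_])
import Data.Sum.Properties as Sum
open import Data.Unit.Polymorphic using (⊤; tt)
import Data.Vec.Functional as Vector
open import Function.Base using (_∘_; id)
open import Function.Bundles using (_↣_; _↔_; mk↣; Injection)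
open import Function.Construct.Composition using (_↣-∘_)
open import Function.Construct.Identity using (↔-id)
open import Level using (Level; Lift; lift; lower) renaming (suc to lsuc)
open import Relation.Binary.Bundles using (Setoid)
open import Relation.Binary.Lattice using (HeytingAlgebra)
open import Relation.Binary.PropositionalEquality using (_≡_; refl; sym; cong)
open import Relation.Nullary using (¬_; Dec; yes; no; ¬?; contradiction)

private
  variable
    ℓ : Level

------------------------------------------------------------------------
-- Complete Heyting algebras

-- "Set" is read as a type in the universe Set ℓ throughout: the carrier, the
-- sections, the symbols, and the index types of joins and meets all live there.

record CompleteHeytingAlgebra ℓ : Set (lsuc ℓ) where
  field
    heytingAlgebra : HeytingAlgebra ℓ ℓ ℓ

  open HeytingAlgebra heytingAlgebra public

  field
    ⋁          : {I : Set ℓ} → (I → Carrier) → Carrier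
    ⋁-upper    : {I : Set ℓ} (f : I → Carrier) → ∀ i → f i ≤ ⋁ f
    ⋁-least    : {I : Set ℓ} (f : I → Carrier) → ∀ x → (∀ i → f i ≤ x) → ⋁ f ≤ x
    ⋀          : {I : Set ℓ} → (I → Carrier) → Carrier
    ⋀-lower    : {I : Set ℓ} (f : I → Carrier) → ∀ i → ⋀ f ≤ f i
    ⋀-greatest : {I : Set ℓ} (f : I → Carrier) → ∀ x → (∀ i → x ≤ f i) → x ≤ ⋀ f

------------------------------------------------------------------------
-- Presheaves

record Presheaf (Ω : CompleteHeytingAlgebra ℓ) : Set (lsuc ℓ) where
  open CompleteHeytingAlgebra Ω using (_≤_; _∧_; ⋁; ⋀) renaming (Carrier to ∣Ω∣; _≈_ to _≈Ω_)

  infixl 8 _↾_ _↾*_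

  field
    sections : Setoid ℓ ℓ

  open Setoid sections public using (_≈_) renaming (Carrier to ∣_∣)

  field
    E      : ∣_∣ → ∣Ω∣
    _↾_    : ∣_∣ → ∣Ω∣ → ∣_∣
    E-cong : ∀ {a b} → a ≈ b → E a ≈Ω E b
    ↾-cong : ∀ {a b p q} → a ≈ b → p ≈Ω q → a ↾ p ≈ b ↾ q
    ↾-E    : ∀ a → a ↾ E a ≈ a
    E-↾    : ∀ a p → E (a ↾ p) ≈Ω E a ∧ p
    ↾-↾    : ∀ a p q → (a ↾ p) ↾ q ≈ a ↾ (p ∧ q)

  [_≐_] : ∣_∣ → ∣_∣ → ∣Ω∣
  [ a ≐ b ] = ⋁ {I = Σ ∣Ω∣ λ p → p ≤ E a ∧ E b × a ↾ p ≈ b ↾ p} proj₁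

  field
    extensional : ∀ a b → E a ≈Ω E b → E b ≈Ω [ a ≐ b ] → a ≈ b

  -- Tuples indexed by an arbitrary set A; for empty A, E* is the top element.
  E* : {A : Set ℓ} → (A → ∣_∣) → ∣Ω∣
  E* ā = ⋀ (E ∘ ā)

  _↾*_ : {A : Set ℓ} → (A → ∣_∣) → ∣Ω∣ → (A → ∣_∣)
  (ā ↾* p) i = ā i ↾ p

  [_≐*_] : {A : Set ℓ} → (A → ∣_∣) → (A → ∣_∣) → ∣Ω∣
  [ ā ≐* b̄ ] = ⋀ λ i → [ ā i ≐ b̄ i ]

open Presheaf public using (∣_∣)

------------------------------------------------------------------------
-- Signatures and structures

Ix : ℕ → Set ℓ
Ix {ℓ} n = Lift ℓ (Fin n)

record Signature (Ω : CompleteHeytingAlgebra ℓ) : Set (lsuc ℓ) where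
  field
    Rel       : Set ℓ
    rel-arity : Rel → ℕ
    Fun       : Set ℓ
    fun-arity : Fun → ℕ
    constants : Presheaf Ω

  Con : Set ℓ
  Con = ∣ constants ∣

record Structure (Ω : CompleteHeytingAlgebra ℓ) (σ : Signature Ω) : Set (lsuc ℓ) where
  open CompleteHeytingAlgebra Ω using (_≤_; _∧_) renaming (Carrier to ∣Ω∣; _≈_ to _≈Ω_)
  open Signature σ
  private module C = Presheaf constants

  field
    presheaf : Presheaf Ω

  open Presheaf presheaf public renaming (∣_∣ to Section)

  field
    relᴹ        : (R : Rel) → (Ix {ℓ} (rel-arity R) → Section) → ∣Ω∣
    relᴹ-strict : ∀ R ā → relᴹ R ā ≤ E* ā
    relᴹ-subst  : ∀ R ā b̄ → [ ā ≐* b̄ ] ∧ relᴹ R ā ≤ relᴹ R b̄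

    funᴹ        : (f : Fun) → (Ix {ℓ} (fun-arity f) → Section) → Section
    funᴹ-E      : ∀ f ā → E (funᴹ f ā) ≈Ω E* ā
    funᴹ-subst  : ∀ f ā b̄ → [ ā ≐* b̄ ] ≤ [ funᴹ f ā ≐ funᴹ f b̄ ]

    conᴹ        : Con → Section
    conᴹ-cong   : ∀ {c d} → c C.≈ d → conᴹ c ≈ conᴹ d
    conᴹ-E      : ∀ c → E (conᴹ c) ≈Ω C.E c
    conᴹ-↾      : ∀ c p → conᴹ (c C.↾ p) ≈ conᴹ c ↾ p

------------------------------------------------------------------------
-- Cardinality

-- A cardinal is represented by a set having that cardinality.
infix 4 _<ᶜ_

_<ᶜ_ : Set ℓ → Set ℓ → Set ℓ
V <ᶜ Λ = (V ↣ Λ) × ¬ (Λ ↣ V)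

-- Dedekind's definition: Λ injects into itself missing at least one point.
Infinite : Set ℓ → Set ℓ
Infinite {ℓ} Λ = (⊤ {ℓ} ⊎ Λ) ↣ Λ

ω : Set ℓ
ω {ℓ} = Lift ℓ ℕ

------------------------------------------------------------------------
-- Languages

data Logic ℓ : Set (lsuc ℓ) where
  L̄ωω : Logic ℓ
  L̄∞ω : Logic ℓ
  L∞   : (Λ : Set ℓ) → Infinite Λ → Logic ℓ

card : Logic ℓ → Set ℓ
card L̄ωω    = ω
card L̄∞ω    = ω
card (L∞ Λ _) = Λ

-- The index sets over which conjunctions and disjunctions may be formed.
Connective : Logic ℓ → Set ℓ → Set ℓ
Connective L̄ωω     I = I <ᶜ ω
Connective L̄∞ω     I = ⊤
Connective (L∞ _ _) I = ⊤

-- The sets of variables that one quantifier may bind.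
Quantifiable : Logic ℓ → Set ℓ → Set ℓ
Quantifiable {ℓ} L̄ωω     V = V ↔ ⊤ {ℓ}
Quantifiable {ℓ} L̄∞ω     V = V ↔ ⊤ {ℓ}
Quantifiable (L∞ Λ _)     V = V <ᶜ Λ

-- Formulae are well scoped: a context is the set of variables that may occur free.
record Context (L : Logic ℓ) : Set (lsuc ℓ) where
  constructor context
  field
    Var   : Set ℓ
    small : Var <ᶜ card L

open Context public using (Var)

module _ {Ω : CompleteHeytingAlgebra ℓ} (σ : Signature Ω) where
  open Signature σ

  data Term (A : Set ℓ) : Set ℓ where
    var : A → Term A
    con : Con → Term A
    fun : (f : Fun) → (Ix {ℓ} (fun-arity f) → Term A) → Term A

  infix 6 _≐_
  infixr 5 _⇒_

  -- A binder over V leads from V ⊎ Var Γ to Var Γ.  That V ⊎ Var Γ again has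
  -- fewer than λ elements follows classically from the same for V and Var Γ, but
  -- not constructively, so it is recorded.
  data Formula (L : Logic ℓ) (Γ : Context L) : Set (lsuc ℓ) where
    _≐_  : Term (Var Γ) → Term (Var Γ) → Formula L Γ
    rel  : (R : Rel) → (Ix {ℓ} (rel-arity R) → Term (Var Γ)) → Formula L Γ
    neg  : Formula L Γ → Formula L Γ
    _⇒_  : Formula L Γ → Formula L Γ → Formula L Γ
    conj : (I : Set ℓ) → Connective L I → (I → Formula L Γ) → Formula L Γ
    disj : (I : Set ℓ) → Connective L I → (I → Formula L Γ) → Formula L Γ
    all  : (V : Set ℓ) → Quantifiable L V → (s : (V ⊎ Var Γ) <ᶜ card L) →
           Formula L (context (V ⊎ Var Γ) s) → Formula L Γ
    ex   : (V : Set ℓ) → Quantifiable L V → (s : (V ⊎ Var Γ) <ᶜ card L) →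
           Formula L (context (V ⊎ Var Γ) s) → Formula L Γ

------------------------------------------------------------------------
-- Interpretation

module _ {Ω : CompleteHeytingAlgebra ℓ} {σ : Signature Ω} where
  open CompleteHeytingAlgebra Ω using (_∧_; _⇨_; ⋁; ⋀) renaming (Carrier to ∣Ω∣; ⊥ to ⊥Ω)
  open Signature σ
  private module C = Presheaf constants

  infix 4 _occursInᵗ_ _occursIn_

  _occursInᵗ_ : {A : Set ℓ} → Con → Term σ A → Set ℓ
  c occursInᵗ var _    = ⊥
  c occursInᵗ con d    = c C.≈ d
  c occursInᵗ fun _ ts = ∃ λ i → c occursInᵗ ts i

  _occursIn_ : {L : Logic ℓ} {Γ : Context L} → Con → Formula σ L Γ → Set ℓ
  c occursIn (t ≐ s)      = c occursInᵗ t ⊎ c occursInᵗ s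
  c occursIn rel _ ts     = ∃ λ i → c occursInᵗ ts i
  c occursIn neg φ        = c occursIn φ
  c occursIn (φ ⇒ ψ)      = c occursIn φ ⊎ c occursIn ψ
  c occursIn conj _ _ φ   = ∃ λ i → c occursIn φ i
  c occursIn disj _ _ φ   = ∃ λ i → c occursIn φ i
  c occursIn all _ _ _ φ  = c occursIn φ
  c occursIn ex _ _ _ φ   = c occursIn φ

  Eᶠ : {L : Logic ℓ} {Γ : Context L} → Formula σ L Γ → ∣Ω∣
  Eᶠ φ = ⋀ {I = ∃ λ c → c occursIn φ} λ (c , _) → C.E c

  module _ (M : Structure Ω σ) where
    open Structure M

    -- Only needed when E* ā lies below the extents of the constants of the term,
    -- but the clauses make sense for every ā.  Totality matters for the empty
    -- tuple, whose extent stays the top element under restriction.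
    ⟦_⟧ᵗ : {A : Set ℓ} → Term σ A → (A → Section) → Section
    ⟦ var x ⟧ᵗ    ā = ā x
    ⟦ con c ⟧ᵗ    ā = conᴹ c ↾ E* ā
    ⟦ fun f ts ⟧ᵗ ā = funᴹ f λ i → ⟦ ts i ⟧ᵗ ā

    ⟦_⟧ : {L : Logic ℓ} {Γ : Context L} → Formula σ L Γ → (Var Γ → Section) → ∣Ω∣
    ⟦ φ@(t ≐ s) ⟧      ā = (E* ā ∧ Eᶠ φ) ∧ [ ⟦ t ⟧ᵗ (ā ↾* Eᶠ φ) ≐ ⟦ s ⟧ᵗ (ā ↾* Eᶠ φ) ]
    ⟦ φ@(rel R ts) ⟧   ā = (E* ā ∧ Eᶠ φ) ∧ relᴹ R (λ i → ⟦ ts i ⟧ᵗ (ā ↾* Eᶠ φ))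
    ⟦ φ@(neg ψ) ⟧      ā = (E* ā ∧ Eᶠ φ) ∧ (⟦ ψ ⟧ ā ⇨ ⊥Ω)
    ⟦ φ@(ψ ⇒ χ) ⟧      ā = (E* ā ∧ Eᶠ φ) ∧ (⟦ ψ ⟧ ā ⇨ ⟦ χ ⟧ ā)
    ⟦ φ@(conj _ _ ψ) ⟧ ā = (E* ā ∧ Eᶠ φ) ∧ ⋀ (λ i → ⟦ ψ i ⟧ ā)
    ⟦ φ@(disj _ _ ψ) ⟧ ā = (E* ā ∧ Eᶠ φ) ∧ ⋁ (λ i → ⟦ ψ i ⟧ ā)
    ⟦ φ@(all V _ _ ψ) ⟧ ā = (E* ā ∧ Eᶠ φ) ∧ ⋀ (λ (t̄ : V → Section) → E* t̄ ⇨ ⟦ ψ ⟧ [ t̄ , ā ])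
    ⟦ φ@(ex V _ _ ψ) ⟧  ā = (E* ā ∧ Eᶠ φ) ∧ ⋁ (λ (t̄ : V → Section) → ⟦ ψ ⟧ [ t̄ , ā ])

------------------------------------------------------------------------
-- Every language has finite connectives and single-variable quantifiers

infinite-ω : Infinite (ω {ℓ})
infinite-ω {ℓ} = mk↣ {to = to} injective
  where
  to : ⊤ {ℓ} ⊎ ω {ℓ} → ω {ℓ}
  to (inj₁ _)        = lift zero
  to (inj₂ (lift n)) = lift (suc n)

  injective : ∀ {x y} → to x ≡ to y → x ≡ y
  injective {inj₁ _} {inj₁ _} _  = refl
  injective {inj₂ _} {inj₂ _} eq = cong (inj₂ ∘ lift) (ℕ.suc-injective (cong lower eq))

card-infinite : (L : Logic ℓ) → Infinite (card L)
card-infinite L̄ωω       = infinite-ω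
card-infinite L̄∞ω       = infinite-ω
card-infinite (L∞ _ inf) = inf

⊤⊎-↣ : {A B : Set ℓ} → A ↣ B → (⊤ {ℓ} ⊎ A) ↣ (⊤ {ℓ} ⊎ B)
⊤⊎-↣ {ℓ} {A} {B} f = mk↣ {to = to} injective
  where
  module f = Injection f

  to : ⊤ {ℓ} ⊎ A → ⊤ {ℓ} ⊎ B
  to (inj₁ _) = inj₁ tt
  to (inj₂ a) = inj₂ (f.to a)

  injective : ∀ {x y} → to x ≡ to y → x ≡ y
  injective {inj₁ _} {inj₁ _} _  = refl
  injective {inj₂ _} {inj₂ _} eq = cong inj₂ (f.injective (Sum.inj₂-injective eq))

⊤⊎-cancel-↣ : {A B : Set ℓ} → (⊤ {ℓ} ⊎ A) ↣ (⊤ {ℓ} ⊎ B) → A ↣ B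
⊤⊎-cancel-↣ {ℓ} {A} {B} f = mk↣ {to = λ a → pick (f.to (inj₂ a)) (f.to (inj₁ tt)) (distinct a)} injective
  where
  module f = Injection f

  distinct : ∀ a → ¬ f.to (inj₂ a) ≡ f.to (inj₁ tt)
  distinct a eq with () ← f.injective eq

  pick : (u v : ⊤ {ℓ} ⊎ B) → ¬ u ≡ v → B
  pick (inj₂ b) _        _   = b
  pick (inj₁ _) (inj₂ b) _   = b
  pick (inj₁ _) (inj₁ _) u≢v = contradiction refl u≢v

  pick-injective : ∀ u u′ v (p : ¬ u ≡ v) (q : ¬ u′ ≡ v) → pick u v p ≡ pick u′ v q → u ≡ u′
  pick-injective (inj₂ _) (inj₂ _) _        _ _ eq = cong inj₂ eq
  pick-injective (inj₂ _) (inj₁ _) (inj₂ _) p _ eq = contradiction (cong inj₂ eq) p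
  pick-injective (inj₁ _) (inj₂ _) (inj₂ _) _ q eq = contradiction (cong inj₂ (sym eq)) q
  pick-injective (inj₁ _) (inj₁ _) _        _ _ _  = refl
  pick-injective (inj₁ _) (inj₂ _) (inj₁ _) p _ _  = contradiction refl p
  pick-injective (inj₂ _) (inj₁ _) (inj₁ _) _ q _  = contradiction refl q

  injective : ∀ {a b} → pick (f.to (inj₂ a)) (f.to (inj₁ tt)) (distinct a) ≡
                        pick (f.to (inj₂ b)) (f.to (inj₁ tt)) (distinct b) → a ≡ b
  injective {a} {b} eq = Sum.inj₂-injective (f.injective
    (pick-injective _ _ (f.to (inj₁ tt)) (distinct a) (distinct b) eq))

⊤⊎-<ᶜ : {V Λ : Set ℓ} → Infinite Λ → V <ᶜ Λ → (⊤ {ℓ} ⊎ V) <ᶜ Λ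
⊤⊎-<ᶜ inf (V↣Λ , Λ↣̸V) =
  inf ↣-∘ ⊤⊎-↣ V↣Λ , λ Λ↣⊤⊎V → Λ↣̸V (⊤⊎-cancel-↣ (Λ↣⊤⊎V ↣-∘ inf))

⊤-<ᶜ : {Λ : Set ℓ} → Infinite Λ → ⊤ {ℓ} <ᶜ Λ
⊤-<ᶜ {ℓ} {Λ} inf = mk↣ {to = λ _ → point} (λ _ → refl) , λ f → absurd (Injection.injective f refl)
  where
  module inf = Injection inf

  point : Λ
  point = inf.to (inj₁ tt)

  absurd : ¬ point ≡ inf.to (inj₂ point)
  absurd eq with () ← inf.injective eq

Ix-<ᶜ-ω : ∀ n → Ix {ℓ} n <ᶜ ω
Ix-<ᶜ-ω n =
  mk↣ {to = λ (lift i) → lift (toℕ i)} (λ eq → cong lift (Fin.toℕ-injective (cong lower eq))) ,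
  λ f → ω↣̸Ix f
  where
  ω↣̸Ix : ¬ (ω ↣ Ix n)
  ω↣̸Ix f with Fin.pigeonhole (ℕ.n<1+n n) (λ i → lower (Injection.to f (lift (toℕ i))))
  ... | i , j , i<j , eq =
    ℕ.<-irrefl (cong lower (Injection.injective f (cong lift eq))) i<j

finite-connective : (L : Logic ℓ) → ∀ n → Connective L (Ix n)
finite-connective L̄ωω     n = Ix-<ᶜ-ω n
finite-connective L̄∞ω     n = tt
finite-connective (L∞ _ _) n = tt

single-quantifiable : (L : Logic ℓ) → Quantifiable L (⊤ {ℓ})
single-quantifiable L̄ωω       = ↔-id _
single-quantifiable L̄∞ω       = ↔-id _
single-quantifiable (L∞ _ inf) = ⊤-<ᶜ inf

------------------------------------------------------------------------
-- Unnesting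

module _ {Ω : CompleteHeytingAlgebra ℓ} {σ : Signature Ω} where
  open Signature σ

  infixl 5 _▹_

  -- Γ ▹ k adds k new variables to Γ, one at a time.
  _▹_ : {L : Logic ℓ} → Context L → ℕ → Context L
  Γ ▹ zero      = Γ
  _▹_ {L} Γ (suc k) = context (⊤ ⊎ Var (Γ ▹ k)) (⊤⊎-<ᶜ (card-infinite L) (Context.small (Γ ▹ k)))

  new : {L : Logic ℓ} {Γ : Context L} {k : ℕ} → Fin k → Var (Γ ▹ k)
  new zero    = inj₁ tt
  new (suc i) = inj₂ (new i)

  old : {L : Logic ℓ} {Γ : Context L} (k : ℕ) → Var Γ → Var (Γ ▹ k)
  old zero    x = x
  old (suc k) x = inj₂ (old k x)

  ∃^ : {L : Logic ℓ} {Γ : Context L} (k : ℕ) → Formula σ L (Γ ▹ k) → Formula σ L Γ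
  ∃^         zero    φ = φ
  ∃^ {L} {Γ} (suc k) φ =
    ∃^ k (ex ⊤ (single-quantifiable L) (Context.small (Γ ▹ suc k)) φ)

  finite-conj : {L : Logic ℓ} {Γ : Context L} {k : ℕ} → (Fin k → Formula σ L Γ) → Formula σ L Γ
  finite-conj {L} {_} {k} φ = conj (Ix k) (finite-connective L k) (φ ∘ lower)

  rename : {A B : Set ℓ} → (A → B) → Term σ A → Term σ B
  rename ρ (var x)    = var (ρ x)
  rename ρ (con c)    = con c
  rename ρ (fun f ts) = fun f λ i → rename ρ (ts i)

  IsVar : {A : Set ℓ} → Term σ A → Set ℓ
  IsVar t = ∃ λ x → t ≡ var x

  isVar? : {A : Set ℓ} (t : Term σ A) → Dec (IsVar t)
  isVar? (var x)   = yes (x , refl)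
  isVar? (con _)   = no λ ()
  isVar? (fun _ _) = no λ ()

  -- The set S of positions of a tuple of terms not occupied by a variable.
  nonVars : {A : Set ℓ} {n : ℕ} → (Ix {ℓ} n → Term σ A) → List (Ix {ℓ} n)
  nonVars {n = n} ts = filter (λ i → ¬? (isVar? (ts i))) (List.map lift (allFin n))

  -- The variables xᵢ, for the terms tᵢ = rename ρ (ts i).
  fresh : {L : Logic ℓ} {Γ : Context L} {A : Set ℓ} {n : ℕ} (ρ : A → Var Γ)
          (ts : Ix {ℓ} n → Term σ A) → Ix {ℓ} n → Var (Γ ▹ length (nonVars ts))
  fresh {Γ = Γ} ρ ts i with isVar? (ts i)
  ... | yes (y , _) = old {Γ = Γ} (length (nonVars ts)) (ρ y)
  ... | no ¬var     = new {Γ = Γ} (index (∈-filter⁺ (λ j → ¬? (isVar? (ts j))) i∈all ¬var))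
    where
    i∈all : i ∈ List.map lift (allFin _)
    i∈all = ∈-map⁺ lift (∈-allFin (lower i))

  -- φ itself if S is empty, and otherwise the existential closure, over new
  -- variables for the elements of S, of the equations together with the last conjunct.
  unnested-or : {L : Logic ℓ} {Γ : Context L} {X : Set ℓ} → Formula σ L Γ → (S : List X) →
                (Fin (length S) → Formula σ L (Γ ▹ length S)) →
                Formula σ L (Γ ▹ length S) → Formula σ L Γ
  unnested-or φ []        _   _    = φ
  unnested-or φ S@(_ ∷ _) eqs last = ∃^ (length S) (finite-conj (last Vector.∷ eqs))

  -- (x = rename ρ t)^∃.  Carrying the renaming ρ, rather than applying it when
  -- passing to a larger context, keeps the recursion structural in t.
  unnestVar : {L : Logic ℓ} {Γ : Context L} {A : Set ℓ} →
              (A → Var Γ) → Var Γ → Term σ A → Formula σ L Γ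
  unnestVar ρ x (var y) = var x ≐ var (ρ y)
  unnestVar ρ x (con c) = var x ≐ con c
  unnestVar {L} {Γ} ρ x (fun f ts) =
    unnested-or (var x ≐ rename ρ (fun f ts)) S
      (λ j → unnestVar (old {Γ = Γ} k ∘ ρ) (new {Γ = Γ} j) (ts (lookup S j)))
      (var (old {Γ = Γ} k x) ≐ fun f (var ∘ fresh {Γ = Γ} ρ ts))
    where
    S = nonVars ts
    k = length S

  infixr 5 _∷ᵗ_

  _∷ᵗ_ : {A : Set ℓ} {n : ℕ} → Term σ A → (Ix {ℓ} n → Term σ A) → (Ix {ℓ} (suc n) → Term σ A)
  (t ∷ᵗ ts) (lift zero)    = t
  (t ∷ᵗ ts) (lift (suc i)) = ts (lift i)

  shift : {n : ℕ} → Ix {ℓ} n → Ix {ℓ} (suc n)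
  shift (lift i) = lift (suc i)

  module _ {L : Logic ℓ} {Γ : Context L} where

    -- (xᵢ = tᵢ)^∃ for i ∈ S, where xᵢ is the new variable chosen for tᵢ.
    equations : {n : ℕ} (ts : Ix {ℓ} n → Term σ (Var Γ)) →
                let k = length (nonVars ts) in Fin k → Formula σ L (Γ ▹ k)
    equations ts j =
      unnestVar (old {Γ = Γ} (length (nonVars ts))) (new {Γ = Γ} j) (ts (lookup (nonVars ts) j))

    -- If both sides are function terms, the clause for f(t₀,…) = tₘ is the one used.
    -- For these two clauses tₘ is put first in the tuple of terms instead of last.
    unnest≐ : Term σ (Var Γ) → Term σ (Var Γ) → Formula σ L Γ
    unnest≐ (var x) s = unnestVar id x s
    unnest≐ (con c) (var x) = con c ≐ var x
    unnest≐ (con c) (con d) =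
      ∃^ 1 (finite-conj ((var (inj₁ tt) ≐ con c) Vector.∷ (var (inj₁ tt) ≐ con d) Vector.∷ Vector.[]))
    unnest≐ t@(con _) s@(fun f ts) =
      unnested-or (t ≐ s) (nonVars (t ∷ᵗ ts)) (equations (t ∷ᵗ ts))
        (var (x (lift zero)) ≐ fun f (var ∘ x ∘ shift))
      where x = fresh {Γ = Γ} id (t ∷ᵗ ts)
    unnest≐ s@(fun f ts) t =
      unnested-or (s ≐ t) (nonVars (t ∷ᵗ ts)) (equations (t ∷ᵗ ts))
        (fun f (var ∘ x ∘ shift) ≐ var (x (lift zero)))
      where x = fresh {Γ = Γ} id (t ∷ᵗ ts)

    unnestRel : (R : Rel) → (Ix {ℓ} (rel-arity R) → Term σ (Var Γ)) → Formula σ L Γ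
    unnestRel R ts =
      unnested-or (rel R ts) (nonVars ts) (equations ts) (rel R (var ∘ fresh {Γ = Γ} id ts))

  infix 9 _^∃

  _^∃ : {L : Logic ℓ} {Γ : Context L} → Formula σ L Γ → Formula σ L Γ
  (t ≐ s) ^∃      = unnest≐ t s
  rel R ts ^∃     = unnestRel R ts
  neg φ ^∃        = neg (φ ^∃)
  (φ ⇒ ψ) ^∃      = φ ^∃ ⇒ ψ ^∃
  conj I fin φ ^∃ = conj I fin λ i → φ i ^∃
  disj I fin φ ^∃ = disj I fin λ i → φ i ^∃
  all V q s φ ^∃  = all V q s (φ ^∃)
  ex V q s φ ^∃   = ex V q s (φ ^∃)

{-# OPTIONS --safe #-}
module Submission where

-- All truth values are compared locally: p ≤ [ a ≐ b ] is a partial equivalence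
-- relation in a and b for each p, term evaluation respects it, and an atomic formula
-- has value E* ā ∧ P(t₀(ā), …) for a strict predicate P respecting it.  Below any p
-- forcing the equations xᵢ = tᵢ, the xᵢ may therefore be replaced by the values of the
-- tᵢ, and conversely these values are witnesses because strictness puts p below their
-- extents.  Unnesting also preserves the constants occurring in a formula, hence the
-- extent Eᶠ met at every connective.

open import Data.Empty.Polymorphic using (⊥-elim)
open import Data.Fin.Base using (Fin; zero; suc)
open import Data.List.Base using (List; []; _∷_; length; lookup)
open import Data.List.Membership.Propositional using (_∈_)
open import Data.List.Membership.Propositional.Properties using (∈-allFin; ∈-map⁺; ∈-filter⁺)
open import Data.List.Relation.Unary.Any using (index)
open import Data.List.Relation.Unary.Any.Properties using (lookup-index)
open import Data.Nat.Base using (ℕ; zero; suc)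
open import Data.Product.Base using (∃; _,_; proj₁)
open import Data.Sum.Base using (_⊎_; inj₁; inj₂; [_,_]; swap)
open import Data.Sum.Function.Propositional using (_⊎-⇔_)
open import Data.Unit.Polymorphic using (⊤; tt)
import Data.Vec.Functional as Vector
open import Function.Base using (_∘_; id)
open import Function.Bundles using (_⇔_; mk⇔; Equivalence)
open import Function.Construct.Composition using (_⇔-∘_)
open import Function.Construct.Identity using (⇔-id)
open import Function.Construct.Symmetry using (⇔-sym)
open import Level using (Level; lift; lower)
open import Relation.Binary.PropositionalEquality using (_≡_; refl; sym; subst)
open import Relation.Nullary using (¬_; yes; no; ¬?; contradiction)
open import Relation.Binary.Bundles using (Setoid)
import Relation.Binary.Lattice.Properties.HeytingAlgebra as HeytingProperties
import Relation.Binary.Lattice.Properties.MeetSemilattice as MeetProperties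

open import Defs

private
  variable
    ℓ : Level

-- Order calculus in a complete Heyting algebra.

module CompleteHeytingProperties (Ω : CompleteHeytingAlgebra ℓ) where
  open CompleteHeytingAlgebra Ω hiding (refl; trans)
  open CompleteHeytingAlgebra Ω public using () renaming (refl to ≤-refl; trans to ≤-trans)

  private
    variable
      I   : Set ℓ
      x y : Carrier

  ∧-elimˡ : ∀ {p} → p ≤ x ∧ y → p ≤ x
  ∧-elimˡ p≤ = ≤-trans p≤ (x∧y≤x _ _)

  ∧-elimʳ : ∀ {p} → p ≤ x ∧ y → p ≤ y
  ∧-elimʳ p≤ = ≤-trans p≤ (x∧y≤y _ _)

  ≤-respʳ : ∀ {z} → x ≈ y → z ≤ x → z ≤ y
  ≤-respʳ x≈y z≤x = ≤-trans z≤x (reflexive x≈y)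

  -- Meeting with `x` has the right adjoint `x ⇨_` and so commutes with joins.
  ⋁∧-least : {f : I → Carrier} → (∀ i → f i ∧ x ≤ y) → ⋁ f ∧ x ≤ y
  ⋁∧-least f∧x≤y = transpose-∧ (⋁-least _ _ λ i → transpose-⇨ (f∧x≤y i))

  ⋁-mono : {f g : I → Carrier} → (∀ i → f i ≤ g i) → ⋁ f ≤ ⋁ g
  ⋁-mono f≤g = ⋁-least _ _ λ i → ≤-trans (f≤g i) (⋁-upper _ i)

  ⋀-mono : {f g : I → Carrier} → (∀ i → f i ≤ g i) → ⋀ f ≤ ⋀ g
  ⋀-mono f≤g = ⋀-greatest _ _ λ i → ≤-trans (⋀-lower _ i) (f≤g i)

  ⋁-cong : {f g : I → Carrier} → (∀ i → f i ≈ g i) → ⋁ f ≈ ⋁ g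
  ⋁-cong f≈g = antisym (⋁-mono (reflexive ∘ f≈g)) (⋁-mono (reflexive ∘ Eq.sym ∘ f≈g))

  ⋀-cong : {f g : I → Carrier} → (∀ i → f i ≈ g i) → ⋀ f ≈ ⋀ g
  ⋀-cong f≈g = antisym (⋀-mono (reflexive ∘ f≈g)) (⋀-mono (reflexive ∘ Eq.sym ∘ f≈g))

-- Local equality of sections.

module PresheafProperties {Ω : CompleteHeytingAlgebra ℓ} (P : Presheaf Ω) where
  open CompleteHeytingAlgebra Ω hiding (refl; trans; _≈_; ⊤; ⊥) renaming (Carrier to ∣Ω∣)
  open CompleteHeytingProperties Ω
  open MeetProperties meetSemilattice using (∧-comm)
  open Presheaf P renaming (∣_∣ to Section)
  open Setoid sections using () renaming (refl to ≈-refl; sym to ≈-sym; trans to ≈-trans)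

  private
    variable
      a b c : Section
      p q   : ∣Ω∣

  ≐-intro : p ≤ E a → p ≤ E b → a ↾ p ≈ b ↾ p → p ≤ [ a ≐ b ]
  ≐-intro p≤Ea p≤Eb eq = ⋁-upper proj₁ (_ , ∧-greatest p≤Ea p≤Eb , eq)

  ≐-Eˡ : p ≤ [ a ≐ b ] → p ≤ E a
  ≐-Eˡ p≤ = ≤-trans p≤ (⋁-least _ _ λ (_ , q≤ , _) → ∧-elimˡ q≤)

  ≐-Eʳ : p ≤ [ a ≐ b ] → p ≤ E b
  ≐-Eʳ p≤ = ≤-trans p≤ (⋁-least _ _ λ (_ , q≤ , _) → ∧-elimʳ q≤)

  ≐-refl : p ≤ E a → p ≤ [ a ≐ a ]
  ≐-refl p≤ = ≐-intro p≤ p≤ ≈-refl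

  ≐-reflexive : a ≡ b → p ≤ E a → p ≤ [ a ≐ b ]
  ≐-reflexive refl = ≐-refl

  ≐-respˡ : a ≡ b → p ≤ [ a ≐ c ] → p ≤ [ b ≐ c ]
  ≐-respˡ refl p≤ = p≤

  ≐-sym : p ≤ [ a ≐ b ] → p ≤ [ b ≐ a ]
  ≐-sym p≤ = ≤-trans p≤ (⋁-least _ _ λ (_ , q≤ , eq) → ≐-intro (∧-elimʳ q≤) (∧-elimˡ q≤) (≈-sym eq))

  -- By distributivity it suffices to treat single stages `q` and `r` witnessing the two equalities;
  -- both restrict to `r ∧ q`, where they compose.
  ≐-trans : p ≤ [ a ≐ b ] → p ≤ [ b ≐ c ] → p ≤ [ a ≐ c ]
  ≐-trans {a = a} {b = b} {c = c} p≤ p≤′ = ≤-trans (∧-greatest p≤ p≤′)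
    (⋁∧-least λ (q , q≤ , eq) → ≤-trans (reflexive (∧-comm _ _))
    (⋁∧-least λ (r , r≤ , eq′) → ≐-intro
      (≤-trans (x∧y≤y _ _) (∧-elimˡ q≤)) (≤-trans (x∧y≤x _ _) (∧-elimʳ r≤))
      (≈-trans (glue q r eq) (glue′ q r eq′))))
    where
    glue : ∀ q r → a ↾ q ≈ b ↾ q → a ↾ (r ∧ q) ≈ b ↾ (r ∧ q)
    glue q r eq = ≈-trans (↾-cong ≈-refl (∧-comm _ _)) (≈-trans (≈-sym (↾-↾ a q r))
      (≈-trans (↾-cong eq Eq.refl) (≈-trans (↾-↾ b q r) (↾-cong ≈-refl (∧-comm _ _)))))

    glue′ : ∀ q r → b ↾ r ≈ c ↾ r → b ↾ (r ∧ q) ≈ c ↾ (r ∧ q)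
    glue′ q r eq = ≈-trans (≈-sym (↾-↾ b r q)) (≈-trans (↾-cong eq Eq.refl) (↾-↾ c r q))

  E-↾⇒E : p ≤ E (a ↾ q) → p ≤ E a
  E-↾⇒E p≤ = ∧-elimˡ (≤-respʳ (E-↾ _ _) p≤)

  -- Since `q ∧ p = p`, restricting `a ↾ q` further to `p` gives `a ↾ p`. This is the tool for
  -- passing between restricted and unrestricted arguments of terms.
  ≐-↾ : p ≤ E a → p ≤ q → p ≤ [ a ≐ a ↾ q ]
  ≐-↾ {p = p} {a = a} {q = q} p≤Ea p≤q = ≐-intro p≤Ea
    (≤-respʳ (Eq.sym (E-↾ _ _)) (∧-greatest p≤Ea p≤q))
    (≈-sym (≈-trans (↾-↾ a q p) (↾-cong ≈-refl (antisym (x∧y≤y _ _) (∧-greatest p≤q ≤-refl)))))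

-- Constants occurring in unnested formulae.

module SignatureProperties {Ω : CompleteHeytingAlgebra ℓ} (σ : Signature Ω) where
  open CompleteHeytingAlgebra Ω using (antisym; ⋀-lower; ⋀-greatest) renaming (_≈_ to _≈Ω_)
  open Signature σ

  private
    variable
      A B : Set ℓ
      L   : Logic ℓ

  infixl 5 _▸_

  -- _▹_, old and new do not determine the implicit Ω and σ of their module.
  _▸_ : Context L → ℕ → Context L
  _▸_ = _▹_ {Ω = Ω} {σ = σ}

  oldᵛ : {Γ : Context L} (k : ℕ) → Var Γ → Var (Γ ▸ k)
  oldᵛ {Γ = Γ} = old {Ω = Ω} {σ = σ} {Γ = Γ}

  newᵛ : {Γ : Context L} {k : ℕ} → Fin k → Var (Γ ▸ k)
  newᵛ {Γ = Γ} = new {Ω = Ω} {σ = σ} {Γ = Γ}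

  -- A constant can sit only inside a non-variable term; this finds the equation that carries it.
  lookup-nonVars : {n : ℕ} (ts : Ix {ℓ} n → Term σ A) {i : Ix n} → ¬ IsVar (ts i) →
                   ∃ λ j → i ≡ lookup (nonVars ts) j
  lookup-nonVars ts {i} ¬var = index i∈S , lookup-index i∈S
    where
    i∈S : i ∈ nonVars ts
    i∈S = ∈-filter⁺ (λ j → ¬? (isVar? (ts j))) (∈-map⁺ lift (∈-allFin (lower i))) ¬var

  occursIn-rename : (ρ : A → B) (t : Term σ A) {c : Con} → c occursInᵗ rename ρ t ⇔ c occursInᵗ t
  occursIn-rename ρ (var x)    = ⇔-id _
  occursIn-rename ρ (con d)    = ⇔-id _
  occursIn-rename ρ (fun f ts) = mk⇔
    (λ (i , o) → i , Equivalence.to (occursIn-rename ρ (ts i)) o)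
    (λ (i , o) → i , Equivalence.from (occursIn-rename ρ (ts i)) o)

  occursIn-∃^ : {L : Logic ℓ} {Γ : Context L} (k : ℕ) (φ : Formula σ L (Γ ▸ k)) {c : Con} →
                c occursIn ∃^ {Γ = Γ} k φ ⇔ c occursIn φ
  occursIn-∃^         zero    φ = ⇔-id _
  occursIn-∃^ {Γ = Γ} (suc k) φ = occursIn-∃^ {Γ = Γ} k (ex ⊤ _ _ φ)

  -- Every constant of the tuple lies in a term with its own equation, and the last conjunct
  -- contributes none.
  occursIn-unnested-or :
    {L : Logic ℓ} {Γ : Context L} {A : Set ℓ} {n : ℕ} (ts : Ix {ℓ} n → Term σ A) →
    let k = length (nonVars ts) in
    {φ : Formula σ L Γ} {eqs : Fin k → Formula σ L (Γ ▸ k)} {last : Formula σ L (Γ ▸ k)} {c : Con} →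
    c occursIn φ ⇔ (∃ λ i → c occursInᵗ ts i) →
    (∀ j → c occursIn eqs j ⇔ c occursInᵗ ts (lookup (nonVars ts) j)) →
    ¬ c occursIn last →
    c occursIn unnested-or {Γ = Γ} φ (nonVars ts) eqs last ⇔ (∃ λ i → c occursInᵗ ts i)
  occursIn-unnested-or {L} {Γ} ts {φ} {eqs} {last} {c} in-φ in-eqs ∉last =
    split (nonVars ts) in-φ (mk⇔ to from ⇔-∘ occursIn-∃^ {Γ = Γ} (length (nonVars ts)) _)
    where
    -- `unnested-or` is stuck on `nonVars ts`, whereas an arbitrary list `S` can be matched on.
    split : {X : Set ℓ} {Q : Set ℓ} (S : List X) {eqs : Fin (length S) → Formula σ L (Γ ▸ length S)}
            {last : Formula σ L (Γ ▸ length S)} → c occursIn φ ⇔ Q →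
            c occursIn ∃^ {Γ = Γ} (length S) (finite-conj (last Vector.∷ eqs)) ⇔ Q →
            c occursIn unnested-or {Γ = Γ} φ S eqs last ⇔ Q
    split []      in-φ _    = in-φ
    split (_ ∷ _) _    in-∃ = in-∃

    to : c occursIn finite-conj (last Vector.∷ eqs) → ∃ λ i → c occursInᵗ ts i
    to (lift zero    , o) = contradiction o ∉last
    to (lift (suc j) , o) = _ , Equivalence.to (in-eqs j) o

    from : (∃ λ i → c occursInᵗ ts i) → c occursIn finite-conj (last Vector.∷ eqs)
    from (i , o) with isVar? (ts i)
    ... | yes (_ , eq) = ⊥-elim (subst (c occursInᵗ_) eq o)
    ... | no ¬var with lookup-nonVars ts ¬var
    ...   | j , eq = lift (suc j) , Equivalence.from (in-eqs j) (subst (λ i → c occursInᵗ ts i) eq o)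

  occursIn-unnestVar : {L : Logic ℓ} {Γ : Context L} {A : Set ℓ} (ρ : A → Var Γ) (x : Var Γ) (t : Term σ A)
                       {c : Con} → c occursIn unnestVar {L = L} {Γ} ρ x t ⇔ c occursInᵗ t
  occursIn-unnestVar ρ x (var y) = mk⇔ [ id , id ] inj₁
  occursIn-unnestVar ρ x (con d) = mk⇔ [ ⊥-elim , id ] inj₂
  occursIn-unnestVar {L} {Γ} ρ x (fun f ts) = occursIn-unnested-or {Γ = Γ} ts
    (occursIn-rename ρ (fun f ts) ⇔-∘ mk⇔ [ ⊥-elim , id ] inj₂)
    (λ j → occursIn-unnestVar {L} {Γ ▸ k} (oldᵛ {Γ = Γ} k ∘ ρ) (newᵛ {Γ = Γ} j) (ts (lookup (nonVars ts) j)))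
    λ { (inj₁ ()) ; (inj₂ (_ , ())) }
    where
    k = length (nonVars ts)

  occursIn-unnested-equations :
    {L : Logic ℓ} {Γ : Context L} {n : ℕ} (ts : Ix {ℓ} n → Term σ (Var Γ)) →
    let k = length (nonVars ts) in
    {φ : Formula σ L Γ} {last : Formula σ L (Γ ▸ k)} {c : Con} →
    c occursIn φ ⇔ (∃ λ i → c occursInᵗ ts i) → ¬ c occursIn last →
    c occursIn unnested-or {Γ = Γ} φ (nonVars ts) (equations ts) last ⇔ (∃ λ i → c occursInᵗ ts i)
  occursIn-unnested-equations {L} {Γ} ts in-φ =
    occursIn-unnested-or {Γ = Γ} ts in-φ λ j →
      occursIn-unnestVar {L} {Γ ▸ k} (oldᵛ {Γ = Γ} k) (newᵛ {Γ = Γ} j) (ts (lookup (nonVars ts) j))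
    where
    k = length (nonVars ts)

  occursIn-∷ᵗ : {n : ℕ} (t : Term σ A) (ts : Ix {ℓ} n → Term σ A) {c : Con} →
                (c occursInᵗ t ⊎ ∃ λ i → c occursInᵗ ts i) ⇔ (∃ λ i → c occursInᵗ (t ∷ᵗ ts) i)
  occursIn-∷ᵗ t ts = mk⇔
    [ (λ o → lift zero , o) , (λ (lift i , o) → lift (suc i) , o) ]
    λ { (lift zero , o) → inj₁ o ; (lift (suc i) , o) → inj₂ (lift i , o) }

  occursIn-unnest≐ : {L : Logic ℓ} {Γ : Context L} (t s : Term σ (Var Γ)) {c : Con} →
                     c occursIn unnest≐ {L = L} {Γ} t s ⇔ (c occursInᵗ t ⊎ c occursInᵗ s)
  occursIn-unnest≐ {L} {Γ} (var x) s = mk⇔ inj₂ [ ⊥-elim , id ] ⇔-∘ occursIn-unnestVar {L} {Γ} id x s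
  occursIn-unnest≐ (con c) (var x) = ⇔-id _
  occursIn-unnest≐ (con c) (con d) = mk⇔
    (λ { (lift zero , inj₂ o) → inj₁ o ; (lift (suc zero) , inj₂ o) → inj₂ o })
    [ (λ o → lift zero , inj₂ o) , (λ o → lift (suc zero) , inj₂ o) ]
  occursIn-unnest≐ {L} {Γ} (con d) (fun f ts) =
    ⇔-sym (occursIn-∷ᵗ (con d) ts) ⇔-∘
    occursIn-unnested-equations {Γ = Γ} (con d ∷ᵗ ts) {con d ≐ fun f ts} (occursIn-∷ᵗ (con d) ts)
      λ { (inj₁ ()) ; (inj₂ (_ , ())) }
  occursIn-unnest≐ {L} {Γ} (fun f ts) t =
    ⇔-sym swapped ⇔-∘ occursIn-unnested-equations {Γ = Γ} (t ∷ᵗ ts) {fun f ts ≐ t} swapped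
      λ { (inj₁ (_ , ())) ; (inj₂ ()) }
    where
    -- The tuple begins with the right-hand side of the equation, so the two sides trade places.
    swapped : ∀ {c} → (c occursInᵗ fun f ts ⊎ c occursInᵗ t) ⇔ (∃ λ i → c occursInᵗ (t ∷ᵗ ts) i)
    swapped = occursIn-∷ᵗ t ts ⇔-∘ mk⇔ swap swap

  occursIn-^∃ : {L : Logic ℓ} {Γ : Context L} (φ : Formula σ L Γ) {c : Con} →
                c occursIn φ ^∃ ⇔ c occursIn φ
  occursIn-^∃ {L} {Γ} (t ≐ s) = occursIn-unnest≐ {L} {Γ} t s
  occursIn-^∃ {L} {Γ} (rel R ts) = occursIn-unnested-equations {Γ = Γ} ts (⇔-id _)
    λ { (_ , ()) }
  occursIn-^∃ (neg φ)      = occursIn-^∃ φ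
  occursIn-^∃ (φ ⇒ ψ)      = occursIn-^∃ φ ⊎-⇔ occursIn-^∃ ψ
  occursIn-^∃ (conj _ _ φ) = mk⇔
    (λ (i , o) → i , Equivalence.to (occursIn-^∃ (φ i)) o)
    (λ (i , o) → i , Equivalence.from (occursIn-^∃ (φ i)) o)
  occursIn-^∃ (disj _ _ φ) = mk⇔
    (λ (i , o) → i , Equivalence.to (occursIn-^∃ (φ i)) o)
    (λ (i , o) → i , Equivalence.from (occursIn-^∃ (φ i)) o)
  occursIn-^∃ (all _ _ _ φ) = occursIn-^∃ φ
  occursIn-^∃ (ex _ _ _ φ)  = occursIn-^∃ φ

  -- Unnesting keeps the set of constants, and the extent met at an occurrence depends on the
  -- constant alone.
  Eᶠ-^∃ : {L : Logic ℓ} {Γ : Context L} (φ : Formula σ L Γ) → Eᶠ φ ≈Ω Eᶠ (φ ^∃)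
  Eᶠ-^∃ φ = antisym
    (⋀-greatest _ _ λ (c , o) → ⋀-lower _ (c , Equivalence.to (occursIn-^∃ φ) o))
    (⋀-greatest _ _ λ (c , o) → ⋀-lower _ (c , Equivalence.from (occursIn-^∃ φ) o))

-- Local evaluation of terms and atomic formulae.

module StructureProperties {Ω : CompleteHeytingAlgebra ℓ} {σ : Signature Ω} (M : Structure Ω σ) where
  open CompleteHeytingAlgebra Ω hiding (refl; trans; _≈_; ⊤; ⊥) renaming (Carrier to ∣Ω∣)
  open CompleteHeytingAlgebra Ω using () renaming (_≈_ to _≈Ω_)
  open CompleteHeytingProperties Ω
  open HeytingProperties heytingAlgebra using (⇨-cong)
  open MeetProperties meetSemilattice using (∧-cong)
  open Signature σ
  open Structure M
  open PresheafProperties presheaf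
  open SignatureProperties σ
  private module C = Presheaf constants

  private
    variable
      A B : Set ℓ
      p q : ∣Ω∣
      L   : Logic ℓ
      Γ   : Context L

  funᴹ-≐ : ∀ f {ā b̄} → (∀ i → p ≤ [ ā i ≐ b̄ i ]) → p ≤ [ funᴹ f ā ≐ funᴹ f b̄ ]
  funᴹ-≐ f ā≐b̄ = ≤-trans (⋀-greatest _ _ ā≐b̄) (funᴹ-subst f _ _)

  funᴹ-E⁻ : ∀ f {ā} → p ≤ E (funᴹ f ā) → ∀ i → p ≤ E (ā i)
  funᴹ-E⁻ f p≤ i = ≤-trans (≤-respʳ (funᴹ-E f _) p≤) (⋀-lower _ i)

  -- A constant depends on the assignment through its restriction to `E* ā`. Both restrictions agree
  -- with `conᴹ c` below `p` once `p` lies below the extent of `conᴹ c`, which the hypothesis on the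
  -- value supplies.
  ⟦⟧ᵗ-local : (t : Term σ A) {ā b̄ : A → Section} → (∀ x → p ≤ [ ā x ≐ b̄ x ]) →
              p ≤ E (⟦ M ⟧ᵗ t ā) → p ≤ [ ⟦ M ⟧ᵗ t ā ≐ ⟦ M ⟧ᵗ t b̄ ]
  ⟦⟧ᵗ-local (var x)    ā≐b̄ _   = ā≐b̄ x
  ⟦⟧ᵗ-local (con c)    ā≐b̄ p≤E = ≐-trans
    (≐-sym (≐-↾ (E-↾⇒E p≤E) (⋀-greatest _ _ (≐-Eˡ ∘ ā≐b̄))))
    (≐-↾ (E-↾⇒E p≤E) (⋀-greatest _ _ (≐-Eʳ ∘ ā≐b̄)))
  ⟦⟧ᵗ-local (fun f ts) ā≐b̄ p≤E =
    funᴹ-≐ f λ i → ⟦⟧ᵗ-local (ts i) ā≐b̄ (funᴹ-E⁻ f p≤E i)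

  E*-∘ : (ρ : A → B) (ā : B → Section) → E* ā ≤ E* (ā ∘ ρ)
  E*-∘ ρ ā = ⋀-greatest _ _ λ x → ⋀-lower _ (ρ x)

  -- At a constant the values are restrictions to `E* ā` and to the possibly larger `E* (ā ∘ ρ)`,
  -- since `ρ` may miss variables. They are therefore compared only below `E* ā`.
  ⟦rename⟧ᵗ : (ρ : A → B) (t : Term σ A) {ā : B → Section} → p ≤ E* ā →
              p ≤ E (⟦ M ⟧ᵗ t (ā ∘ ρ)) → p ≤ [ ⟦ M ⟧ᵗ (rename ρ t) ā ≐ ⟦ M ⟧ᵗ t (ā ∘ ρ) ]
  ⟦rename⟧ᵗ ρ (var x)    p≤E* p≤E = ≐-refl p≤E
  ⟦rename⟧ᵗ ρ (con c)    p≤E* p≤E = ≐-trans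
    (≐-sym (≐-↾ (E-↾⇒E p≤E) p≤E*)) (≐-↾ (E-↾⇒E p≤E) (≤-trans p≤E* (E*-∘ ρ _)))
  ⟦rename⟧ᵗ ρ (fun f ts) p≤E* p≤E =
    funᴹ-≐ f λ i → ⟦rename⟧ᵗ ρ (ts i) p≤E* (funᴹ-E⁻ f p≤E i)

  -- Supplies the extent hypothesis of `⟦rename⟧ᵗ` when only the renamed term is known to be
  -- defined.
  E-⟦rename⟧ᵗ : (ρ : A → B) (t : Term σ A) {ā : B → Section} →
                p ≤ E (⟦ M ⟧ᵗ (rename ρ t) ā) → p ≤ E (⟦ M ⟧ᵗ t (ā ∘ ρ))
  E-⟦rename⟧ᵗ ρ (var x)    p≤E = p≤E
  E-⟦rename⟧ᵗ ρ (con c)    p≤E = ≤-respʳ (Eq.sym (E-↾ _ _))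
    (∧-greatest (E-↾⇒E p≤E) (≤-trans (∧-elimʳ (≤-respʳ (E-↾ _ _) p≤E)) (E*-∘ ρ _)))
  E-⟦rename⟧ᵗ ρ (fun f ts) p≤E = ≤-respʳ (Eq.sym (funᴹ-E f _))
    (⋀-greatest _ _ λ i → E-⟦rename⟧ᵗ ρ (ts i) (funᴹ-E⁻ f p≤E i))

  -- The extent of a function value is the meet of the extents of its arguments, so it lies below
  -- those of all constants inside. Hence an atomic formula that holds forces its own `Eᶠ`.
  E-con : (t : Term σ A) {ā : A → Section} {c : Con} → c occursInᵗ t →
          p ≤ E (⟦ M ⟧ᵗ t ā) → p ≤ C.E c
  E-con (con d)    c≈d     p≤E = ≤-respʳ (Eq.trans (conᴹ-E d) (Eq.sym (C.E-cong c≈d))) (E-↾⇒E p≤E)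
  E-con (fun f ts) (i , o) p≤E = E-con (ts i) o (funᴹ-E⁻ f p≤E i)

  ⟦⟧ᵗ-↾* : (t : Term σ A) {ā : A → Section} → p ≤ E* ā → p ≤ q →
           p ≤ E (⟦ M ⟧ᵗ t ā) → p ≤ [ ⟦ M ⟧ᵗ t ā ≐ ⟦ M ⟧ᵗ t (ā ↾* q) ]
  ⟦⟧ᵗ-↾* t p≤E* p≤q = ⟦⟧ᵗ-local t λ x → ≐-↾ (≤-trans p≤E* (⋀-lower _ x)) p≤q

  ⟦⟧ᵗ-↾*⁻ : (t : Term σ A) {ā : A → Section} → p ≤ E* ā → p ≤ q →
            p ≤ E (⟦ M ⟧ᵗ t (ā ↾* q)) → p ≤ [ ⟦ M ⟧ᵗ t (ā ↾* q) ≐ ⟦ M ⟧ᵗ t ā ]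
  ⟦⟧ᵗ-↾*⁻ t p≤E* p≤q = ⟦⟧ᵗ-local t λ x → ≐-sym (≐-↾ (≤-trans p≤E* (⋀-lower _ x)) p≤q)

  -- Terms may be evaluated without restricting the arguments to the extents of the
  -- constants: an equation already forces these extents.
  ⟦≐⟧ : (t s : Term σ (Var Γ)) {ā : Var Γ → Section} →
        ⟦ M ⟧ {L} {Γ} (t ≐ s) ā ≈Ω E* ā ∧ [ ⟦ M ⟧ᵗ t ā ≐ ⟦ M ⟧ᵗ s ā ]
  ⟦≐⟧ t s = antisym
    (let p≤E*  = ∧-elimˡ (x∧y≤x _ _)
         p≤e   = ∧-elimʳ (x∧y≤x _ _)
         p≤t≐s = x∧y≤y _ _
     in ∧-greatest p≤E*
          (≐-trans (≐-sym (⟦⟧ᵗ-↾*⁻ t p≤E* p≤e (≐-Eˡ p≤t≐s)))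
          (≐-trans p≤t≐s (⟦⟧ᵗ-↾*⁻ s p≤E* p≤e (≐-Eʳ p≤t≐s)))))
    (let p≤E*  = x∧y≤x _ _
         p≤t≐s = x∧y≤y _ _
         p≤e   = ⋀-greatest _ _ λ (_ , o) →
                   [ (λ o → E-con t o (≐-Eˡ p≤t≐s)) , (λ o → E-con s o (≐-Eʳ p≤t≐s)) ] o
     in ∧-greatest (∧-greatest p≤E* p≤e)
          (≐-trans (≐-sym (⟦⟧ᵗ-↾* t p≤E* p≤e (≐-Eˡ p≤t≐s)))
          (≐-trans p≤t≐s (⟦⟧ᵗ-↾* s p≤E* p≤e (≐-Eʳ p≤t≐s)))))

  -- Isolates what unnesting uses of the last conjunct: `holds-strict` makes the term values
  -- defined, hence usable as witnesses, and `holds-local` lets new variables be replaced by those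
  -- values.
  record StrictPredicate (A : Set ℓ) : Set ℓ where
    field
      holds        : (A → Section) → ∣Ω∣
      holds-strict : ∀ {p ā} → p ≤ holds ā → ∀ i → p ≤ E (ā i)
      holds-local  : ∀ {p ā b̄} → (∀ i → p ≤ [ ā i ≐ b̄ i ]) → p ≤ holds ā → p ≤ holds b̄

  open StrictPredicate

  relation : (R : Rel) → StrictPredicate (Ix (rel-arity R))
  relation R = record
    { holds        = relᴹ R
    ; holds-strict = λ p≤ i → ≤-trans p≤ (≤-trans (relᴹ-strict R _) (⋀-lower _ i))
    ; holds-local  = λ ā≐b̄ p≤ → ≤-trans (∧-greatest (⋀-greatest _ _ ā≐b̄) p≤) (relᴹ-subst R _ _)
    }

  -- For equations whose left side is a variable: it gets no new variable, so its value `a` stays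
  -- outside the tuple.
  _equals_ : Section → (f : Fun) → StrictPredicate (Ix (fun-arity f))
  a equals f = record
    { holds        = λ b̄ → [ a ≐ funᴹ f b̄ ]
    ; holds-strict = λ p≤ → funᴹ-E⁻ f (≐-Eʳ p≤)
    ; holds-local  = λ b̄≐c̄ p≤ → ≐-trans p≤ (funᴹ-≐ f b̄≐c̄)
    }

  -- Here the side opposite `f` may itself need a new variable, so it joins the tuple as its head.
  head-equals : (f : Fun) → StrictPredicate (Ix (suc (fun-arity f)))
  head-equals f = record
    { holds        = λ b̄ → [ b̄ (lift zero) ≐ funᴹ f (b̄ ∘ shift {Ω = Ω} {σ = σ}) ]
    ; holds-strict = λ { p≤ (lift zero) → ≐-Eˡ p≤ ; p≤ (lift (suc i)) → funᴹ-E⁻ f (≐-Eʳ p≤) (lift i) }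
    ; holds-local  = λ b̄≐c̄ p≤ → ≐-trans (≐-sym (b̄≐c̄ _)) (≐-trans p≤ (funᴹ-≐ f (b̄≐c̄ ∘ shift {Ω = Ω} {σ = σ})))
    }

  equals-head : (f : Fun) → StrictPredicate (Ix (suc (fun-arity f)))
  equals-head f = record
    { holds        = λ b̄ → [ funᴹ f (b̄ ∘ shift {Ω = Ω} {σ = σ}) ≐ b̄ (lift zero) ]
    ; holds-strict = λ p≤ → holds-strict (head-equals f) (≐-sym p≤)
    ; holds-local  = λ b̄≐c̄ p≤ → ≐-sym (holds-local (head-equals f) b̄≐c̄ (≐-sym p≤))
    }

  -- Strictness of `relᴹ` makes every argument defined, which both forces the extents of the
  -- constants and allows the restriction of `ā` to be dropped or restored.
  ⟦rel⟧ : (R : Rel) (ts : Ix (rel-arity R) → Term σ (Var Γ)) {ā : Var Γ → Section} →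
          ⟦ M ⟧ {L} {Γ} (rel R ts) ā ≈Ω E* ā ∧ relᴹ R (λ i → ⟦ M ⟧ᵗ (ts i) ā)
  ⟦rel⟧ R ts = antisym
    (let p≤E* = ∧-elimˡ (x∧y≤x _ _)
         p≤e  = ∧-elimʳ (x∧y≤x _ _)
         p≤R  = x∧y≤y _ _
     in ∧-greatest p≤E* (holds-local (relation R)
          (λ i → ⟦⟧ᵗ-↾*⁻ (ts i) p≤E* p≤e (holds-strict (relation R) p≤R i)) p≤R))
    (let p≤E* = x∧y≤x _ _
         p≤R  = x∧y≤y _ _
         p≤e  = ⋀-greatest _ _ λ (_ , i , o) → E-con (ts i) o (holds-strict (relation R) p≤R i)
     in ∧-greatest (∧-greatest p≤E* p≤e) (holds-local (relation R)
          (λ i → ⟦⟧ᵗ-↾* (ts i) p≤E* p≤e (holds-strict (relation R) p≤R i)) p≤R))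

  ⟦⟧-strict : (φ : Formula σ L Γ) (ā : Var Γ → Section) → ⟦ M ⟧ φ ā ≤ E* ā ∧ Eᶠ φ
  ⟦⟧-strict (_ ≐ _)       ā = x∧y≤x _ _
  ⟦⟧-strict (rel _ _)     ā = x∧y≤x _ _
  ⟦⟧-strict (neg _)       ā = x∧y≤x _ _
  ⟦⟧-strict (_ ⇒ _)       ā = x∧y≤x _ _
  ⟦⟧-strict (conj _ _ _)  ā = x∧y≤x _ _
  ⟦⟧-strict (disj _ _ _)  ā = x∧y≤x _ _
  ⟦⟧-strict (all _ _ _ _) ā = x∧y≤x _ _
  ⟦⟧-strict (ex _ _ _ _)  ā = x∧y≤x _ _

  -- Blocks of existential quantifiers and finite conjunctions.

  extend : {Γ : Context L} (k : ℕ) → (Fin k → Section) → (Var Γ → Section) → Var (Γ ▸ k) → Section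
  extend         zero    b̄ ā = ā
  -- The latest variable is the outer summand, which makes this definitionally an assignment from
  -- the clause for `ex`.
  extend {Γ = Γ} (suc k) b̄ ā = [ (λ _ → b̄ zero) , extend {Γ = Γ} k (b̄ ∘ suc) ā ]

  extend-old : {Γ : Context L} (k : ℕ) (b̄ : Fin k → Section) (ā : Var Γ → Section) (x : Var Γ) →
               extend {Γ = Γ} k b̄ ā (oldᵛ {Γ = Γ} k x) ≡ ā x
  extend-old         zero    b̄ ā x = refl
  extend-old {Γ = Γ} (suc k) b̄ ā x = extend-old {Γ = Γ} k (b̄ ∘ suc) ā x

  extend-new : {Γ : Context L} {k : ℕ} (b̄ : Fin k → Section) (ā : Var Γ → Section) (j : Fin k) →
               extend {Γ = Γ} k b̄ ā (newᵛ {Γ = Γ} j) ≡ b̄ j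
  extend-new         b̄ ā zero    = refl
  extend-new {Γ = Γ} b̄ ā (suc j) = extend-new {Γ = Γ} (b̄ ∘ suc) ā j

  E*-extend : {Γ : Context L} (k : ℕ) {b̄ : Fin k → Section} {ā : Var Γ → Section} →
              (∀ j → p ≤ E (b̄ j)) → p ≤ E* ā → p ≤ E* (extend {Γ = Γ} k b̄ ā)
  E*-extend         zero    p≤Eb̄ p≤Eā = p≤Eā
  E*-extend {Γ = Γ} (suc k) p≤Eb̄ p≤Eā = ⋀-greatest _ _
    λ { (inj₁ _) → p≤Eb̄ zero
      ; (inj₂ x) → ≤-trans (E*-extend {Γ = Γ} k (p≤Eb̄ ∘ suc) p≤Eā) (⋀-lower _ x) }

  E*-extend⁻ : {Γ : Context L} (k : ℕ) {b̄ : Fin k → Section} {ā : Var Γ → Section} →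
               p ≤ E* (extend {Γ = Γ} k b̄ ā) → p ≤ E* ā
  E*-extend⁻ {Γ = Γ} k p≤E* = ⋀-greatest _ _ λ x →
    subst (λ a → _ ≤ E a) (extend-old {Γ = Γ} k _ _ x) (≤-trans p≤E* (⋀-lower _ (oldᵛ {Γ = Γ} k x)))

  ⟦∃^⟧-intro : {Γ : Context L} (k : ℕ) (φ : Formula σ L (Γ ▸ k)) (b̄ : Fin k → Section) (ā : Var Γ → Section) →
               ⟦ M ⟧ φ (extend {Γ = Γ} k b̄ ā) ≤ ⟦ M ⟧ (∃^ {Γ = Γ} k φ) ā
  ⟦∃^⟧-intro         zero    φ b̄ ā = ≤-refl
  ⟦∃^⟧-intro {Γ = Γ} (suc k) φ b̄ ā = ≤-trans
    (∧-greatest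
      -- The factor `e` of the quantified formula comes from strictness of `φ`: dropping the newest
      -- variable enlarges `E*`, and the constants are the same.
      (∧-greatest (≤-trans (∧-elimˡ (⟦⟧-strict φ _)) (E*-∘ inj₂ _)) (∧-elimʳ (⟦⟧-strict φ _)))
      (⋁-upper _ λ _ → b̄ zero))
    (⟦∃^⟧-intro {Γ = Γ} k (ex ⊤ _ _ φ) (b̄ ∘ suc) ā)

  ⟦∃^⟧-elim : {Γ : Context L} (k : ℕ) (φ : Formula σ L (Γ ▸ k)) (ā : Var Γ → Section) →
              (∀ b̄ → ⟦ M ⟧ φ (extend {Γ = Γ} k b̄ ā) ≤ p) → ⟦ M ⟧ (∃^ {Γ = Γ} k φ) ā ≤ p
  ⟦∃^⟧-elim         zero    φ ā φ≤p = φ≤p λ ()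
  ⟦∃^⟧-elim {Γ = Γ} (suc k) φ ā φ≤p = ⟦∃^⟧-elim {Γ = Γ} k (ex ⊤ _ _ φ) ā λ b̄ →
    -- By eta for the unit type, `t̄` is the constant family at `t̄ tt`.
    ≤-trans (x∧y≤y _ _) (⋁-least _ _ λ t̄ → φ≤p (t̄ tt Vector.∷ b̄))

  -- Each constant occurs in some conjunct, whose strictness gives its extent. The bound by `E* ā`
  -- is assumed separately because the conjunction may be empty.
  ⟦finite-conj⟧-intro : {k : ℕ} (φ : Fin k → Formula σ L Γ) {ā : Var Γ → Section} →
                        p ≤ E* ā → (∀ j → p ≤ ⟦ M ⟧ (φ j) ā) → p ≤ ⟦ M ⟧ (finite-conj φ) ā
  ⟦finite-conj⟧-intro φ p≤E* p≤φ = ∧-greatest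
    (∧-greatest p≤E* (⋀-greatest _ _ λ (c , j , o) →
      ≤-trans (∧-elimʳ (≤-trans (p≤φ (lower j)) (⟦⟧-strict (φ (lower j)) _))) (⋀-lower _ (c , o))))
    (⋀-greatest _ _ (p≤φ ∘ lower))

  ⟦finite-conj⟧-elim : {k : ℕ} (φ : Fin k → Formula σ L Γ) {ā : Var Γ → Section} →
                       p ≤ ⟦ M ⟧ (finite-conj φ) ā → ∀ j → p ≤ ⟦ M ⟧ (φ j) ā
  ⟦finite-conj⟧-elim φ p≤ j = ≤-trans (∧-elimʳ p≤) (⋀-lower _ (lift j))

  ⟦unnested-or⟧ : {L : Logic ℓ} {Γ : Context L} {X : Set ℓ} {φ : Formula σ L Γ} (S : List X)
                  {eqs : Fin (length S) → Formula σ L (Γ ▸ length S)}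
                  {last : Formula σ L (Γ ▸ length S)} {ā : Var Γ → Section} →
                  ⟦ M ⟧ φ ā ≈Ω p →
                  ⟦ M ⟧ (∃^ {Γ = Γ} (length S) (finite-conj (last Vector.∷ eqs))) ā ≈Ω p →
                  ⟦ M ⟧ (unnested-or {Γ = Γ} φ S eqs last) ā ≈Ω p
  ⟦unnested-or⟧ []      φ≈p _  = φ≈p
  ⟦unnested-or⟧ (_ ∷ _) _   ≈p = ≈p

  -- Elimination of the equations for the new variables.

  module _ {L : Logic ℓ} {Γ : Context L} {A : Set ℓ} {n : ℕ}
           (ρ : A → Var Γ) (ts : Ix {ℓ} n → Term σ A) (ā : Var Γ → Section) where

    private
      S = nonVars ts
      k = length S

      values : Ix n → Section
      values i = ⟦ M ⟧ᵗ (ts i) (ā ∘ ρ)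

      extended : (Fin k → Section) → Var (Γ ▸ k) → Section
      extended b̄ = extend {Γ = Γ} k b̄ ā

    -- The membership proof is arbitrary because the one chosen by `fresh` contains a local
    -- definition; it is then found by unification.
    extend-index : (b̄ : Fin k → Section) → (∀ j → p ≤ [ b̄ j ≐ values (lookup S j) ]) →
                   ∀ {i} (i∈S : i ∈ S) → p ≤ [ extended b̄ (newᵛ {Γ = Γ} (index i∈S)) ≐ values i ]
    extend-index {p = p} b̄ p≤eqs {i} i∈S = ≐-respˡ
      (sym (extend-new {Γ = Γ} b̄ ā (index i∈S)))
      (subst (λ i → p ≤ [ b̄ (index i∈S) ≐ values i ]) (sym (lookup-index i∈S)) (p≤eqs (index i∈S)))

    extend-fresh : (b̄ : Fin k → Section) → p ≤ E* ā → (∀ j → p ≤ [ b̄ j ≐ values (lookup S j) ]) →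
                   ∀ i → p ≤ [ extended b̄ (fresh {Γ = Γ} ρ ts i) ≐ values i ]
    extend-fresh {p = p} b̄ p≤E* p≤eqs i with isVar? (ts i)
    ... | yes (y , eq) =
      subst (λ t → p ≤ [ extended b̄ (oldᵛ {Γ = Γ} k (ρ y)) ≐ ⟦ M ⟧ᵗ t (ā ∘ ρ) ]) (sym eq)
        (≐-sym (≐-reflexive (sym (extend-old {Γ = Γ} k b̄ ā (ρ y))) (≤-trans p≤E* (⋀-lower _ (ρ y)))))
    ... | no ¬var      = extend-index b̄ p≤eqs _

    -- Equations and last conjunct enter only through their truth values, so one argument serves
    -- relations and all forms of equations, and the first hypothesis can be filled by the induction
    -- hypothesis on subterms.
    ⟦∃^-equations⟧ :
      (P : StrictPredicate (Ix n)) {eqs : Fin k → Formula σ L (Γ ▸ k)} {last : Formula σ L (Γ ▸ k)} →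
      (∀ b̄ j → let c̄ = extended b̄ in
        ⟦ M ⟧ (eqs j) c̄ ≈Ω
        E* c̄ ∧ [ c̄ (newᵛ {Γ = Γ} j) ≐ ⟦ M ⟧ᵗ (ts (lookup S j)) (c̄ ∘ oldᵛ {Γ = Γ} k ∘ ρ) ]) →
      (∀ b̄ → let c̄ = extended b̄ in
        ⟦ M ⟧ last c̄ ≈Ω E* c̄ ∧ holds P (c̄ ∘ fresh {Γ = Γ} ρ ts)) →
      ⟦ M ⟧ (∃^ {Γ = Γ} k (finite-conj (last Vector.∷ eqs))) ā ≈Ω E* ā ∧ holds P values
    ⟦∃^-equations⟧ P {eqs} {last} ⟦eqs⟧ ⟦last⟧ = antisym
      (⟦∃^⟧-elim {Γ = Γ} k φ ā only)
      (≤-trans witness (⟦∃^⟧-intro {Γ = Γ} k φ (values ∘ lookup S) ā))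
      where
      φ = finite-conj (last Vector.∷ eqs)

      old≐ : ∀ {p} b̄ → p ≤ E* ā → ∀ x → p ≤ [ ā (ρ x) ≐ extended b̄ (oldᵛ {Γ = Γ} k (ρ x)) ]
      old≐ b̄ p≤E* x =
        ≐-reflexive (sym (extend-old {Γ = Γ} k b̄ ā (ρ x))) (≤-trans p≤E* (⋀-lower _ (ρ x)))

      only : ∀ b̄ → ⟦ M ⟧ φ (extended b̄) ≤ E* ā ∧ holds P values
      only b̄ = ∧-greatest p≤E*
        (holds-local P (extend-fresh b̄ p≤E* p≤eqs) (∧-elimʳ p≤last))
        where
        p≤last = ≤-respʳ (⟦last⟧ b̄) (⟦finite-conj⟧-elim (last Vector.∷ eqs) ≤-refl zero)
        p≤E*   = E*-extend⁻ {Γ = Γ} k (∧-elimˡ p≤last)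

        p≤eqs : ∀ j → ⟦ M ⟧ φ (extended b̄) ≤ [ b̄ j ≐ values (lookup S j) ]
        -- The equation evaluates its term at the extended assignment; locality carries the value
        -- back to `ā`.
        p≤eqs j = ≐-respˡ (extend-new {Γ = Γ} b̄ ā j)
          (≐-trans p≤eq (⟦⟧ᵗ-local (ts (lookup S j)) (≐-sym ∘ old≐ b̄ p≤E*) (≐-Eʳ p≤eq)))
          where
          p≤eq = ∧-elimʳ (≤-respʳ (⟦eqs⟧ b̄ j) (⟦finite-conj⟧-elim (last Vector.∷ eqs) ≤-refl (suc j)))

      witness : E* ā ∧ holds P values ≤ ⟦ M ⟧ φ (extended (values ∘ lookup S))
      witness = ⟦finite-conj⟧-intro (last Vector.∷ eqs) p≤E*c̄
        λ { zero    → ≤-respʳ (Eq.sym (⟦last⟧ b̄)) (∧-greatest p≤E*c̄ (holds-local P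
                        (≐-sym ∘ extend-fresh b̄ p≤E* (λ j → ≐-refl (p≤Eb̄ j))) p≤P))
          ; (suc j) → ≤-respʳ (Eq.sym (⟦eqs⟧ b̄ j)) (∧-greatest p≤E*c̄
                        (≐-respˡ (sym (extend-new {Γ = Γ} b̄ ā j))
                          (⟦⟧ᵗ-local (ts (lookup S j)) (old≐ b̄ p≤E*) (p≤Eb̄ j)))) }
        where
        b̄     = values ∘ lookup S
        p≤E*  = x∧y≤x _ _
        p≤P   = x∧y≤y _ _
        p≤Eb̄  : ∀ j → _ ≤ E (b̄ j)
        -- The witnesses are the term values at the positions in `S`, and strictness of `P` makes
        -- them exist at this stage.
        p≤Eb̄ j = holds-strict P p≤P (lookup S j)
        p≤E*c̄ = E*-extend {Γ = Γ} k p≤Eb̄ p≤E*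

  -- Truth values of unnested formulae.

  ⟦≐-rename⟧ : {L : Logic ℓ} {Γ : Context L} {A : Set ℓ} (ρ : A → Var Γ) (x : Var Γ) (t : Term σ A)
               {ā : Var Γ → Section} →
               ⟦ M ⟧ {L} {Γ} (var x ≐ rename ρ t) ā ≈Ω E* ā ∧ [ ā x ≐ ⟦ M ⟧ᵗ t (ā ∘ ρ) ]
  ⟦≐-rename⟧ {L} {Γ} ρ x t = Eq.trans (⟦≐⟧ {L = L} {Γ} (var x) (rename ρ t)) (antisym
    (∧-greatest (x∧y≤x _ _)
      -- Only the renamed term is known to be defined here; in the other direction it is the
      -- original one.
      (≐-trans (x∧y≤y _ _) (⟦rename⟧ᵗ ρ t (x∧y≤x _ _) (E-⟦rename⟧ᵗ ρ t (≐-Eʳ (x∧y≤y _ _))))))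
    (∧-greatest (x∧y≤x _ _)
      (≐-trans (x∧y≤y _ _) (≐-sym (⟦rename⟧ᵗ ρ t (x∧y≤x _ _) (≐-Eʳ (x∧y≤y _ _)))))))

  -- Induction on `t` for all contexts and renamings at once, since subterms are unnested over the
  -- extended context with `old` composed onto `ρ`.
  ⟦unnestVar⟧ : {L : Logic ℓ} {Γ : Context L} {A : Set ℓ} (ρ : A → Var Γ) (x : Var Γ) (t : Term σ A)
                (ā : Var Γ → Section) →
                ⟦ M ⟧ (unnestVar {L = L} {Γ} ρ x t) ā ≈Ω E* ā ∧ [ ā x ≐ ⟦ M ⟧ᵗ t (ā ∘ ρ) ]
  ⟦unnestVar⟧ {L} {Γ} ρ x (var y)    ā = ⟦≐-rename⟧ {L} {Γ} ρ x (var y)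
  ⟦unnestVar⟧ {L} {Γ} ρ x (con c)    ā = ⟦≐-rename⟧ {L} {Γ} ρ x (con c)
  ⟦unnestVar⟧ {L} {Γ} ρ x (fun f ts) ā = ⟦unnested-or⟧ (nonVars ts)
    (⟦≐-rename⟧ {L} {Γ} ρ x (fun f ts))
    (⟦∃^-equations⟧ {Γ = Γ} ρ ts ā (ā x equals f)
      (λ b̄ j → ⟦unnestVar⟧ {L} {Γ ▸ length (nonVars ts)} (oldᵛ {Γ = Γ} k ∘ ρ) (newᵛ {Γ = Γ} j)
                 (ts (lookup (nonVars ts) j)) _)
      (λ b̄ → let c̄ = extend {Γ = Γ} k b̄ ā in
        -- As `k` is not a numeral, reading the old variable `x` in `c̄` yields `ā x` only up to a
        -- propositional equality.
        subst (λ a → ⟦ M ⟧ last c̄ ≈Ω E* c̄ ∧ [ a ≐ funᴹ f (c̄ ∘ fresh {Γ = Γ} ρ ts) ])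
          (extend-old {Γ = Γ} k b̄ ā x)
          (⟦≐⟧ {L = L} {Γ ▸ k} (var (oldᵛ {Γ = Γ} k x)) (fun f (var ∘ fresh {Γ = Γ} ρ ts)))))
    where
    k = length (nonVars ts)

    last : Formula σ L (Γ ▸ k)
    last = var (oldᵛ {Γ = Γ} k x) ≐ fun f (var ∘ fresh {Γ = Γ} ρ ts)

  ⟦unnested-equations⟧ :
    {L : Logic ℓ} {Γ : Context L} {n : ℕ} (ts : Ix {ℓ} n → Term σ (Var Γ)) →
    let k = length (nonVars ts) in
    (P : StrictPredicate (Ix n)) (φ : Formula σ L Γ) (last : Formula σ L (Γ ▸ k)) (ā : Var Γ → Section) →
    ⟦ M ⟧ φ ā ≈Ω E* ā ∧ holds P (λ i → ⟦ M ⟧ᵗ (ts i) ā) →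
    (∀ c̄ → ⟦ M ⟧ last c̄ ≈Ω E* c̄ ∧ holds P (c̄ ∘ fresh {Γ = Γ} id ts)) →
    ⟦ M ⟧ φ ā ≈Ω ⟦ M ⟧ (unnested-or {Γ = Γ} φ (nonVars ts) (equations ts) last) ā
  ⟦unnested-equations⟧ {L} {Γ} ts P φ last ā ⟦φ⟧ ⟦last⟧ =
    Eq.trans ⟦φ⟧ (Eq.sym (⟦unnested-or⟧ {φ = φ} (nonVars ts) {last = last} ⟦φ⟧
      (⟦∃^-equations⟧ {Γ = Γ} id ts ā P {last = last}
        (λ b̄ j → ⟦unnestVar⟧ {L} {Γ ▸ k} (oldᵛ {Γ = Γ} k) (newᵛ {Γ = Γ} j) (ts (lookup (nonVars ts) j)) _)
        (λ b̄ → ⟦last⟧ _))))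
    where
    k = length (nonVars ts)

  ⟦unnest≐⟧ : {L : Logic ℓ} {Γ : Context L} (t s : Term σ (Var Γ)) (ā : Var Γ → Section) →
              ⟦ M ⟧ {L} {Γ} (t ≐ s) ā ≈Ω ⟦ M ⟧ (unnest≐ {L = L} {Γ} t s) ā
  ⟦unnest≐⟧ {L} {Γ} (var x) s ā =
    Eq.trans (⟦≐⟧ {L = L} {Γ} (var x) s) (Eq.sym (⟦unnestVar⟧ {L} {Γ} id x s ā))
  ⟦unnest≐⟧ (con c) (var x) ā = Eq.refl
  ⟦unnest≐⟧ {L} {Γ} (con c) (con d) ā = Eq.trans (⟦≐⟧ {L = L} {Γ} (con c) (con d)) (antisym
    (≤-trans
      (⟦finite-conj⟧-intro φ p≤E*c̄
        λ { zero       → ≤-respʳ (Eq.sym (⟦φ₀⟧ b̄)) (∧-greatest p≤E*c̄ (≐-refl (≐-Eˡ (x∧y≤y _ _))))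
          ; (suc zero) → ≤-respʳ (Eq.sym (⟦φ₁⟧ b̄)) (∧-greatest p≤E*c̄ (x∧y≤y _ _)) })
      (⟦∃^⟧-intro {Γ = Γ} 1 (finite-conj φ) b̄ ā))
    (⟦∃^⟧-elim {Γ = Γ} 1 (finite-conj φ) ā λ b̄ →
      let p≤φ₀ = ≤-respʳ (⟦φ₀⟧ b̄) (⟦finite-conj⟧-elim φ ≤-refl zero)
          p≤φ₁ = ≤-respʳ (⟦φ₁⟧ b̄) (⟦finite-conj⟧-elim φ ≤-refl (suc zero))
      in ∧-greatest (E*-extend⁻ {Γ = Γ} 1 {b̄} (∧-elimˡ p≤φ₀))
           (≐-trans (≐-sym (∧-elimʳ p≤φ₀)) (∧-elimʳ p≤φ₁))))
    where
    φ : Fin 2 → Formula σ L (Γ ▸ 1)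
    φ = (var (inj₁ tt) ≐ con c) Vector.∷ (var (inj₁ tt) ≐ con d) Vector.∷ Vector.[]

    -- Viewing the constant as renamed along `inj₂` lets it be evaluated at `ā` itself, not at the
    -- extended assignment.
    ⟦φ₀⟧ = λ b̄ → ⟦≐-rename⟧ {L} {Γ ▸ 1} inj₂ (inj₁ tt) (con c) {extend {Γ = Γ} 1 b̄ ā}
    ⟦φ₁⟧ = λ b̄ → ⟦≐-rename⟧ {L} {Γ ▸ 1} inj₂ (inj₁ tt) (con d) {extend {Γ = Γ} 1 b̄ ā}

    b̄ : Fin 1 → Section
    -- The two constants share one new variable, and the value of `c` witnesses both equations.
    b̄ _ = ⟦ M ⟧ᵗ (con c) ā

    p≤E*c̄ : E* ā ∧ [ ⟦ M ⟧ᵗ (con c) ā ≐ ⟦ M ⟧ᵗ (con d) ā ] ≤ E* (extend {Γ = Γ} 1 b̄ ā)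
    p≤E*c̄ = E*-extend {Γ = Γ} 1 {b̄} (λ _ → ≐-Eˡ (x∧y≤y _ _)) (x∧y≤x _ _)
  ⟦unnest≐⟧ {L} {Γ} (con c) (fun f ts) ā =
    ⟦unnested-equations⟧ {Γ = Γ} (con c ∷ᵗ ts) (head-equals f) (con c ≐ fun f ts)
      (var (x (lift zero)) ≐ fun f (var ∘ x ∘ shift {Ω = Ω} {σ = σ})) ā
      (⟦≐⟧ {L = L} {Γ} (con c) (fun f ts))
      (λ c̄ → ⟦≐⟧ {L = L} {Γ ▸ k} (var (x (lift zero))) (fun f (var ∘ x ∘ shift {Ω = Ω} {σ = σ})))
    where
    k = length (nonVars (con c ∷ᵗ ts))
    x = fresh {Γ = Γ} id (con c ∷ᵗ ts)
  ⟦unnest≐⟧ {L} {Γ} (fun f ts) t ā =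
    ⟦unnested-equations⟧ {Γ = Γ} (t ∷ᵗ ts) (equals-head f) (fun f ts ≐ t)
      (fun f (var ∘ x ∘ shift {Ω = Ω} {σ = σ}) ≐ var (x (lift zero))) ā
      (⟦≐⟧ {L = L} {Γ} (fun f ts) t)
      (λ c̄ → ⟦≐⟧ {L = L} {Γ ▸ k} (fun f (var ∘ x ∘ shift {Ω = Ω} {σ = σ})) (var (x (lift zero))))
    where
    k = length (nonVars (t ∷ᵗ ts))
    x = fresh {Γ = Γ} id (t ∷ᵗ ts)

  ⟦unnestRel⟧ : {L : Logic ℓ} {Γ : Context L} (R : Rel) (ts : Ix {ℓ} (rel-arity R) → Term σ (Var Γ))
                (ā : Var Γ → Section) →
                ⟦ M ⟧ {L} {Γ} (rel R ts) ā ≈Ω ⟦ M ⟧ (unnestRel {L = L} {Γ} R ts) ā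
  ⟦unnestRel⟧ {L} {Γ} R ts ā =
    ⟦unnested-equations⟧ {Γ = Γ} ts (relation R) (rel R ts) (rel R (var ∘ x)) ā
      (⟦rel⟧ {L = L} {Γ} R ts)
      (λ c̄ → ⟦rel⟧ {L = L} {Γ ▸ length (nonVars ts)} R (var ∘ x))
    where
    x = fresh {Γ = Γ} id ts

  -- Compound clauses follow by congruence, but `Eᶠ` is read off the formula and not off the values
  -- of its subformulae, so its invariance enters at each connective and quantifier.
  ⟦^∃⟧ : {L : Logic ℓ} {Γ : Context L} (φ : Formula σ L Γ) (ā : Var Γ → Section) →
         ⟦ M ⟧ φ ā ≈Ω ⟦ M ⟧ (φ ^∃) ā
  ⟦^∃⟧ {L} {Γ} (t ≐ s)    ā = ⟦unnest≐⟧ {L} {Γ} t s ā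
  ⟦^∃⟧ {L} {Γ} (rel R ts) ā = ⟦unnestRel⟧ {L} {Γ} R ts ā
  ⟦^∃⟧ φ@(neg ψ)      ā = ∧-cong (∧-cong Eq.refl (Eᶠ-^∃ φ)) (⇨-cong (⟦^∃⟧ ψ ā) Eq.refl)
  ⟦^∃⟧ φ@(ψ ⇒ χ)      ā = ∧-cong (∧-cong Eq.refl (Eᶠ-^∃ φ)) (⇨-cong (⟦^∃⟧ ψ ā) (⟦^∃⟧ χ ā))
  ⟦^∃⟧ φ@(conj _ _ ψ) ā = ∧-cong (∧-cong Eq.refl (Eᶠ-^∃ φ)) (⋀-cong λ i → ⟦^∃⟧ (ψ i) ā)
  ⟦^∃⟧ φ@(disj _ _ ψ) ā = ∧-cong (∧-cong Eq.refl (Eᶠ-^∃ φ)) (⋁-cong λ i → ⟦^∃⟧ (ψ i) ā)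
  ⟦^∃⟧ φ@(all _ _ _ ψ) ā =
    ∧-cong (∧-cong Eq.refl (Eᶠ-^∃ φ)) (⋀-cong λ t̄ → ⇨-cong Eq.refl (⟦^∃⟧ ψ [ t̄ , ā ]))
  ⟦^∃⟧ φ@(ex _ _ _ ψ) ā =
    ∧-cong (∧-cong Eq.refl (Eᶠ-^∃ φ)) (⋁-cong λ t̄ → ⟦^∃⟧ ψ [ t̄ , ā ])

corollary7p7 : {ℓ : Level} (Ω : CompleteHeytingAlgebra ℓ) (σ : Signature Ω) (L : Logic ℓ)
    (Γ : Context L) (ψ : Formula σ L Γ) (M : Structure Ω σ)
    (ā : Var Γ → Structure.Section M) →
    CompleteHeytingAlgebra._≈_ Ω (⟦_⟧ M ψ ā) (⟦_⟧ M (ψ ^∃) ā)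
corollary7p7 Ω σ L Γ ψ M ā = StructureProperties.⟦^∃⟧ M ψ ā
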